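{- $i(\vec P_3)\leq 0.4446$ and $i(\vec C_4)\leq 0.1104$.
   Context: An orgraph (oriented graph) is a directed graph with no loops, no multiple edges, and no pair of vertices joined by edges in both directions. For a finite orgraph $\Gamma$ and an integer $n$, let $max(\Gamma;n)$ be the maximum, over all orgraphs $G$ on $n$ vertices, of the number of vertex subsets $T\subseteq V(G)$ with $|T|=|V(\Gamma)|$ such that the subgraph of $G$ induced by $T$ is isomorphic to $\Gamma$ (each such set is counted once, regardless of automorphisms of $\Gamma$). The inducibility of $\Gamma$ is $i(\Gamma):=\limsup_{n\to\infty} max(\Gamma;n)/\binom{n}{|V(\Gamma)|}$. Here $\vec P_3$ is the orgraph on vertices $a,b,c$ with edges $a\to b$ and $b\to c$ only (directed path with 3 vertices), and $\vec C_4$ is the orgraph on vertices $v_1,v_2,v_3,v_4$ with edges $v_1\to v_2$, $v_2\to v_3$, $v_3\to v_4$, $v_4\to v_1$ only (directed 4-cycle). -}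

module Defs where

open import Data.Bool using (Bool; true; false)
import Data.Bool.Properties as Bool
open import Data.Fin using (Fin; zero; suc)
import Data.Fin.Properties as Fin
open import Data.Fin.Subset using (Subset; _∈_; ∣_∣)
open import Data.Fin.Subset.Properties using (_∈?_)
open import Data.Integer using (+_)
open import Data.List using (List; []; _∷_; [_]; length; filter; mapMaybe; allFin; cartesianProductWith)
open import Data.List.Extrema.Nat using (argmax; v≤f[argmax]⁺)
import Data.List.Membership.Propositional as List
open import Data.List.Membership.Propositional.Properties using (∈-cartesianProductWith⁺; ∈-allFin)
open import Data.List.Properties using (filter-≐)
open import Data.List.Relation.Unary.All using ([]; _∷_)
open import Data.List.Relation.Unary.AllPairs using ([]; _∷_)
open import Data.List.Relation.Unary.Any as Any using (Any; here; there)
open import Data.List.Relation.Unary.Any.Properties using (mapMaybe⁺; map⁺)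
open import Data.List.Relation.Unary.Unique.Propositional using (Unique)
import Data.List.Relation.Unary.Unique.Propositional.Properties as Unique
open import Data.Maybe using (Maybe; just)
import Data.Maybe as Maybe
open import Data.Maybe.Relation.Unary.Any as MAny using (just)
open import Data.Nat as ℕ using (ℕ; zero; suc; _+_)
import Data.Nat.Properties as ℕ
open import Data.Nat.Combinatorics using (_C_)
open import Data.Product using (Σ-syntax; ∃-syntax; _×_; _,_; proj₁; proj₂)
open import Data.Rational as ℚ using (ℚ; 0ℚ; _/_)
import Data.Rational.Properties as ℚ
open import Data.Sum using (inj₂)
open import Data.Vec using (Vec; []; _∷_; lookup; tabulate; here; there)
open import Data.Vec.Properties using (∷-injectiveˡ; ∷-injectiveʳ; lookup∘tabulate)
open import Function using (_↔_; Inverse; mk↔ₛ′)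
open import Relation.Binary.PropositionalEquality using (_≡_; refl; sym; trans; cong; cong₂; subst)
open import Relation.Nullary using (Dec; yes; no; contradiction)
open import Relation.Nullary.Decidable using (map′; _×-dec_; _→-dec_)

record IsOrgraph {V : Set} (edge : V → V → Bool) : Set where
  field
    loopless : ∀ v → edge v v ≡ false
    oriented : ∀ u v → edge u v ≡ true → edge v u ≡ false

record Orgraph (V : Set) : Set where
  field
    edge      : V → V → Bool
    isOrgraph : IsOrgraph edge
  open IsOrgraph isOrgraph public

open Orgraph

record _≅_ {V W : Set} (G : Orgraph V) (H : Orgraph W) : Set where
  field
    bijection : V ↔ W
  open Inverse bijection public using (to; from)
  field
    edge-≡ : ∀ u v → edge G u v ≡ edge H (to u) (to v)

induced : ∀ {n} → Orgraph (Fin n) → (T : Subset n) → Orgraph (∃[ v ] v ∈ T)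
induced G T .edge u v = edge G (proj₁ u) (proj₁ v)
induced G T .isOrgraph = record
  { loopless = λ v → loopless G (proj₁ v)
  ; oriented = λ u v → oriented G (proj₁ u) (proj₁ v)
  }

edgeless : ∀ {V} → Orgraph V
edgeless .edge _ _ = false
edgeless .isOrgraph = record { loopless = λ _ → refl ; oriented = λ _ _ _ → refl }

P₃ : Orgraph (Fin 3)
P₃ = record { edge = e ; isOrgraph = record { loopless = l ; oriented = o } }
  where
  e : Fin 3 → Fin 3 → Bool
  e zero       (suc zero)       = true
  e (suc zero) (suc (suc zero)) = true
  e _          _                = false

  l : ∀ v → e v v ≡ false
  l zero             = refl
  l (suc zero)       = refl
  l (suc (suc zero)) = refl

  o : ∀ u v → e u v ≡ true → e v u ≡ false
  o zero       (suc zero)       _ = refl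
  o (suc zero) (suc (suc zero)) _ = refl

C₄ : Orgraph (Fin 4)
C₄ = record { edge = e ; isOrgraph = record { loopless = l ; oriented = o } }
  where
  e : Fin 4 → Fin 4 → Bool
  e zero                   (suc zero)             = true
  e (suc zero)             (suc (suc zero))       = true
  e (suc (suc zero))       (suc (suc (suc zero))) = true
  e (suc (suc (suc zero))) zero                   = true
  e _                      _                      = false

  l : ∀ v → e v v ≡ false
  l zero                   = refl
  l (suc zero)             = refl
  l (suc (suc zero))       = refl
  l (suc (suc (suc zero))) = refl

  o : ∀ u v → e u v ≡ true → e v u ≡ false
  o zero                   (suc zero)             _ = refl
  o (suc zero)             (suc (suc zero))       _ = refl
  o (suc (suc zero))       (suc (suc (suc zero))) _ = refl
  o (suc (suc (suc zero))) zero                   _ = refl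

vecs : ∀ {A : Set} → List A → ∀ n → List (Vec A n)
vecs xs zero    = [ [] ]
vecs xs (suc n) = cartesianProductWith _∷_ xs (vecs xs n)

∈-vecs : ∀ {A : Set} {xs : List A} → (∀ x → x List.∈ xs) →
         ∀ {n} (v : Vec A n) → v List.∈ vecs xs n
∈-vecs all []      = here refl
∈-vecs all (x ∷ v) = ∈-cartesianProductWith⁺ _∷_ (all x) (∈-vecs all v)

vecs-unique : ∀ {A : Set} {xs : List A} → Unique xs → ∀ n → Unique (vecs xs n)
vecs-unique u zero    = [] ∷ []
vecs-unique u (suc n) =
  Unique.cartesianProductWith⁺ _∷_ (λ eq → ∷-injectiveˡ eq , ∷-injectiveʳ eq) u (vecs-unique u n)

bools : List Bool
bools = false ∷ true ∷ []

∈-bools : ∀ b → b List.∈ bools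
∈-bools false = here refl
∈-bools true  = there (here refl)

subsets : ∀ n → List (Subset n)
subsets = vecs bools

∈-subsets : ∀ {n} (T : Subset n) → T List.∈ subsets n
∈-subsets = ∈-vecs ∈-bools

subsets-unique : ∀ n → Unique (subsets n)
subsets-unique = vecs-unique (((λ ()) ∷ []) ∷ [] ∷ [])

isOrgraph? : ∀ {n} (e : Fin n → Fin n → Bool) → Dec (IsOrgraph e)
isOrgraph? e = map′
  (λ (l , o) → record { loopless = l ; oriented = o })
  (λ i → IsOrgraph.loopless i , IsOrgraph.oriented i)
  (Fin.all? (λ v → e v v Bool.≟ false) ×-dec
   Fin.all? (λ u → Fin.all? (λ v → (e u v Bool.≟ true) →-dec (e v u Bool.≟ false))))

fromMatrix : ∀ {n} → Vec (Vec Bool n) n → Maybe (Orgraph (Fin n))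
fromMatrix M with isOrgraph? (λ u v → lookup (lookup M u) v)
... | yes p = just (record { edge = λ u v → lookup (lookup M u) v ; isOrgraph = p })
... | no  _ = Maybe.nothing

orgraphs : ∀ n → List (Orgraph (Fin n))
orgraphs n = mapMaybe fromMatrix (vecs (vecs bools n) n)

_≈_ : ∀ {V} → Orgraph V → Orgraph V → Set
G ≈ H = ∀ u v → edge G u v ≡ edge H u v

orgraphs-complete : ∀ {n} (G : Orgraph (Fin n)) → Any (G ≈_) (orgraphs n)
orgraphs-complete {n} G =
  mapMaybe⁺ fromMatrix _ (map⁺ (Any.map (λ { refl → fromMatrix-M }) (∈-vecs (∈-vecs ∈-bools) M)))
  where
  M : Vec (Vec Bool n) n
  M = tabulate (λ u → tabulate (edge G u))

  eq : ∀ u v → edge G u v ≡ lookup (lookup M u) v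
  eq u v = sym (trans (cong (λ r → lookup r v) (lookup∘tabulate _ u)) (lookup∘tabulate (edge G u) v))

  fromMatrix-M : MAny.Any (G ≈_) (fromMatrix M)
  fromMatrix-M with isOrgraph? (λ u v → lookup (lookup M u) v)
  ... | yes _ = just eq
  ... | no ¬p = contradiction
    (record { loopless = λ v → trans (sym (eq v v)) (loopless G v)
            ; oriented = λ u v h → trans (sym (eq v u)) (oriented G u v (trans (eq u v) h)) })
    ¬p

∈-irrelevant : ∀ {n} {v : Fin n} {T : Subset n} (p q : v ∈ T) → p ≡ q
∈-irrelevant here      here      = refl
∈-irrelevant (there p) (there q) = cong there (∈-irrelevant p q)

-- f lists the vertices of T in the order of the vertices of Γ.
Lists : ∀ {k n} → Orgraph (Fin k) → Orgraph (Fin n) → Subset n → Vec (Fin n) k → Set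
Lists Γ G T f =
  (∀ i → lookup f i ∈ T) ×
  (∀ v → v ∈ T → ∃[ i ] lookup f i ≡ v) ×
  (∀ i j → lookup f i ≡ lookup f j → i ≡ j) ×
  (∀ i j → edge G (lookup f i) (lookup f j) ≡ edge Γ i j)

lists? : ∀ {k n} (Γ : Orgraph (Fin k)) (G : Orgraph (Fin n)) T f → Dec (Lists Γ G T f)
lists? Γ G T f =
  Fin.all? (λ i → lookup f i ∈? T) ×-dec
  Fin.all? (λ v → (v ∈? T) →-dec Fin.any? (λ i → lookup f i Fin.≟ v)) ×-dec
  Fin.all? (λ i → Fin.all? (λ j → (lookup f i Fin.≟ lookup f j) →-dec (i Fin.≟ j))) ×-dec
  Fin.all? (λ i → Fin.all? (λ j → edge G (lookup f i) (lookup f j) Bool.≟ edge Γ i j))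

lists⇒≅ : ∀ {k n} {Γ : Orgraph (Fin k)} {G : Orgraph (Fin n)} {T f} →
          Lists Γ G T f → induced G T ≅ Γ
lists⇒≅ {k} {Γ = Γ} {G} {T} {f} (f∈T , surj , inj , edges) = record
  { bijection = mk↔ₛ′ index vertex
      (λ i → inj _ _ (proj₂ (surj _ (f∈T i))))
      (λ (v , v∈T) → Σ-≡ (proj₂ (surj v v∈T)))
  ; edge-≡ = λ (u , p) (v , q) →
      trans (sym (cong₂ (edge G) (proj₂ (surj u p)) (proj₂ (surj v q)))) (edges _ _)
  }
  where
  index : (∃[ v ] v ∈ T) → Fin k
  index (v , v∈T) = proj₁ (surj v v∈T)

  vertex : Fin k → ∃[ v ] v ∈ T
  vertex i = lookup f i , f∈T i

  Σ-≡ : ∀ {u v} {p : u ∈ T} {q : v ∈ T} → u ≡ v → (u , p) ≡ (v , q)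
  Σ-≡ refl = cong (_ ,_) (∈-irrelevant _ _)

≅⇒lists : ∀ {k n} {Γ : Orgraph (Fin k)} {G : Orgraph (Fin n)} {T} →
          induced G T ≅ Γ → ∃[ f ] Lists Γ G T f
≅⇒lists {k} {n} {Γ} {G} {T} iso = tabulate g
  , (λ i → subst (_∈ T) (sym (lkp i)) (proj₂ (from i)))
  , (λ v v∈T → to (v , v∈T) , trans (lkp _) (cong proj₁ (strictlyInverseʳ (v , v∈T))))
  , (λ i j eq → from-inj i j (trans (sym (lkp i)) (trans eq (lkp j))))
  , (λ i j → trans (cong₂ (edge G) (lkp i) (lkp j))
               (trans (edge-≡ (from i) (from j))
                      (cong₂ (edge Γ) (strictlyInverseˡ i) (strictlyInverseˡ j))))
  where
  open _≅_ iso
  open Inverse bijection using (strictlyInverseˡ; strictlyInverseʳ)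

  g : Fin k → Fin n
  g i = proj₁ (from i)

  lkp : ∀ i → lookup (tabulate g) i ≡ g i
  lkp = lookup∘tabulate g

  Σ-≡ : ∀ {x y : ∃[ v ] v ∈ T} → proj₁ x ≡ proj₁ y → x ≡ y
  Σ-≡ refl = cong (_ ,_) (∈-irrelevant _ _)

  from-inj : ∀ i j → g i ≡ g j → i ≡ j
  from-inj i j eq =
    trans (sym (strictlyInverseˡ i)) (trans (cong to (Σ-≡ eq)) (strictlyInverseˡ j))

induced≅? : ∀ {k n} (Γ : Orgraph (Fin k)) (G : Orgraph (Fin n)) T → Dec (induced G T ≅ Γ)
induced≅? {k} {n} Γ G T = map′
  (λ a → let f , l = Any.satisfied a in lists⇒≅ {f = f} l)
  (λ iso → let f , l = ≅⇒lists iso in Any.map (λ { refl → l }) (∈-vecs ∈-allFin f))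
  (Any.any? (lists? Γ G T) (vecs (allFin n) k))

IsCopy : ∀ {k n} → Orgraph (Fin k) → Orgraph (Fin n) → Subset n → Set
IsCopy {k} Γ G T = ∣ T ∣ ≡ k × induced G T ≅ Γ

isCopy? : ∀ {k n} (Γ : Orgraph (Fin k)) (G : Orgraph (Fin n)) T → Dec (IsCopy Γ G T)
isCopy? {k} Γ G T = (∣ T ∣ ℕ.≟ k) ×-dec induced≅? Γ G T

copies : ∀ {k n} → Orgraph (Fin k) → Orgraph (Fin n) → ℕ
copies {n = n} Γ G = length (filter (isCopy? Γ G) (subsets n))

max : ∀ {k} → Orgraph (Fin k) → ℕ → ℕ
max Γ n = copies Γ (argmax (copies Γ) edgeless (orgraphs n))

copies-cong : ∀ {k n} (Γ : Orgraph (Fin k)) {G H : Orgraph (Fin n)} → G ≈ H → copies Γ G ≡ copies Γ H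
copies-cong {n = n} Γ {G} {H} G≈H =
  cong length (filter-≐ (isCopy? Γ G) (isCopy? Γ H) (transport G≈H , transport (λ u v → sym (G≈H u v))) (subsets n))
  where
  transport : ∀ {G H} → G ≈ H → ∀ {T} → IsCopy Γ G T → IsCopy Γ H T
  transport G≈H (size , iso) = size , record
    { bijection = _≅_.bijection iso
    ; edge-≡    = λ u v → trans (sym (G≈H _ _)) (_≅_.edge-≡ iso u v)
    }

copies≤max : ∀ {k n} (Γ : Orgraph (Fin k)) (G : Orgraph (Fin n)) → copies Γ G ℕ.≤ max Γ n
copies≤max {n = n} Γ G = v≤f[argmax]⁺ {f = copies Γ} edgeless (orgraphs n)
  (inj₂ (Any.map (λ G≈H → ℕ.≤-reflexive (copies-cong Γ G≈H)) (orgraphs-complete G)))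

max-attained : ∀ {k} (Γ : Orgraph (Fin k)) n → Σ[ G ∈ Orgraph (Fin n) ] copies Γ G ≡ max Γ n
max-attained Γ n = _ , refl

-- Extended upper reals: x is represented by the set of rationals r with
-- x < r.  (The empty set is +∞, the full set is -∞.)

record UpperReal : Set₁ where
  field
    cut     : ℚ → Set
    upward  : ∀ {r s} → r ℚ.≤ s → cut r → cut s
    rounded : ∀ {r} → cut r → ∃[ s ] s ℚ.< r × cut s

open UpperReal

infix 4 _<_ _≤_

_<_ : UpperReal → ℚ → Set
x < r = cut x r

_≤_ : UpperReal → UpperReal → Set
x ≤ y = ∀ r → y < r → x < r

fromℚ : ℚ → UpperReal
fromℚ q = record
  { cut     = λ r → q ℚ.< r
  ; upward  = λ r≤s q<r → ℚ.<-≤-trans q<r r≤s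
  ; rounded = λ q<r → let s , q<s , s<r = ℚ.<-dense q<r in s , s<r , q<s
  }

sup : (ℕ → ℚ) → UpperReal
sup a = record
  { cut     = λ r → ∃[ s ] s ℚ.< r × (∀ n → a n ℚ.≤ s)
  ; upward  = λ r≤t (s , s<r , a≤s) → s , ℚ.<-≤-trans s<r r≤t , a≤s
  ; rounded = λ (s , s<r , a≤s) →
      let t , s<t , t<r = ℚ.<-dense s<r in t , t<r , s , s<t , a≤s
  }

inf : (ℕ → UpperReal) → UpperReal
inf x = record
  { cut     = λ r → ∃[ n ] x n < r
  ; upward  = λ r≤s (n , xₙ<r) → n , upward (x n) r≤s xₙ<r
  ; rounded = λ (n , xₙ<r) →
      let s , s<r , xₙ<s = rounded (x n) xₙ<r in s , s<r , n , xₙ<s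
  }

limsup : (ℕ → ℚ) → UpperReal
limsup a = inf (λ N → sup (λ n → a (N + n)))

-- The value for d = 0 is a convention.  In inducibility it only concerns the
-- terms with n < k, where n C k = 0; they do not affect the limit superior.
ratio : ℕ → ℕ → ℚ
ratio m zero    = 0ℚ
ratio m (suc d) = + m / suc d

inducibility : ∀ {k} → Orgraph (Fin k) → UpperReal
inducibility {k} Γ = limsup (λ n → ratio (max Γ n) (n C k))

{-# OPTIONS --safe #-}
module Submission where

-- Count over all quadruples (a , b , c , d) of vertices of G, repetitions allowed: since G
-- has no loops, each quadruple pulls G back to an orgraph on four vertices, one of 3⁶
-- configurations.  For any flag f, the sum of f(a,b,c) f(a,b,d) over the quadruples with
-- a, b in a given relation is a sum of squares over the pairs (a , b), hence nonnegative.
-- Adding suitable multiples of such sums to the indicator of an embedding of P₃ (or C₄)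
-- and averaging over the 24 orders of a quadruple gives a function on configurations that
-- is pointwise at most a constant, so the number of embeddings is bounded by that constant
-- times the number of tuples, without error term.

open import Data.Integer using (+_)
open import Data.Product using (_×_)
open import Data.Rational using (_/_)
open import Defs

open import Data.Bool using (Bool; true; false; if_then_else_)
open import Data.Bool.Properties using (T-≡)
import Data.Bool.Properties as Bool
open import Data.Fin using (Fin; zero; suc)
open import Data.Fin.Patterns using (0F; 1F; 2F; 3F)
import Data.Fin.Properties as Fin
open import Data.Fin.Subset as Subset using (⊤)
open import Data.Fin.Subset.Properties using (⊆-antisym; ∈⊤)
open import Data.Integer as ℤ using (ℤ; 0ℤ; -_)
import Data.Integer.Properties as ℤ
open import Data.List using (List; []; _∷_; _++_; length; filter; map; allFin; tabulate; cartesianProductWith)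
open import Data.List.Membership.Propositional using (_∈_)
open import Data.List.Membership.Propositional.Properties using (∈-∃++; ∈-++⁺ˡ; ∈-++⁺ʳ; ∈-++⁻; ∈-filter⁺; ∈-filter⁻; ∈-map⁻; ∈-allFin)
open import Data.List.Properties using (length-++; length-++-sucʳ; length-map; filter-++)
open import Data.List.Relation.Binary.Disjoint.Propositional using (Disjoint)
open import Data.List.Relation.Binary.Subset.Propositional using (_⊆_)
open import Data.List.Relation.Unary.All as All using (All; []; _∷_)
import Data.List.Relation.Unary.All.Properties as All
open import Data.List.Relation.Unary.AllPairs using ([]; _∷_)
open import Data.List.Relation.Unary.Any as Any using (Any; here; there)
open import Data.List.Relation.Unary.Unique.Propositional using (Unique)
import Data.List.Relation.Unary.Unique.Propositional.Properties as Unique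
open import Data.Nat as ℕ using (ℕ; zero; suc; NonZero; _!)
open import Data.Nat.Combinatorics using (_C_; nCk≡nPk/k!)
open import Data.Nat.Combinatorics.Base using (_P_; _P′_)
open import Data.Nat.Combinatorics.Specification using (k!∣nP′k)
open import Data.Nat.DivMod using (m*[n/m]≡n)
import Data.Nat.Properties as ℕ
open import Data.Product using (∃-syntax; _,_; proj₁; proj₂)
import Data.Rational as ℚ
import Data.Rational.Properties as ℚ
import Data.Rational.Unnormalised as ℚᵘ
import Data.Rational.Unnormalised.Properties as ℚᵘ
open import Data.Sum using (inj₁; inj₂)
open import Data.Vec as Vec using (Vec; []; _∷_; lookup)
open import Data.Vec.Properties using (lookup-map; ∷-injective)
open import Function using (_∘_; Equivalence)
open import Relation.Binary.PropositionalEquality using (_≡_; refl; sym; trans; cong; cong₂; subst; module ≡-Reasoning)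
open import Relation.Nullary using (Dec; yes; no; does; contradiction)
open import Relation.Nullary.Decidable using (map′; _×-dec_; toWitness)
open import Relation.Unary using (Decidable)
open import Algebra.Properties.Semiring.Sum ℤ.+-*-semiring as Sum using (sum; ∑-distrib-+; sum-cong-≗; *-distribˡ-sum; *-distribʳ-sum)

open Orgraph using (edge; oriented)

-- Asymptotics

limsup≤ : ∀ a {q} N → (∀ n → a (N ℕ.+ n) ℚ.≤ q) → limsup a ≤ fromℚ q
limsup≤ a N a≤q r q<r = N , _ , q<r , a≤q

module _ where
  open import Data.Nat using (_*_; _∸_; _^_)
  open import Algebra.Properties.CommutativeSemigroup ℕ.*-commutativeSemigroup using (interchange; xy∙z≈y∙xz)

  ratio≤ : ∀ m d p q .{{_ : NonZero q}} → q * m ℕ.≤ p * d → ratio m d ℚ.≤ + p / q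
  -- For `d = 0` the ratio is `0ℚ` by convention, so nonnegativity of the bound suffices.
  ratio≤ m zero    p q       _     = ℚ.nonNegative⁻¹ (+ p / q) {{ℚ.normalize-nonNeg p q}}
  ratio≤ m (suc d) p (suc q) qm≤pd = ℚ.toℚᵘ-cancel-≤ (begin
    ℚ.toℚᵘ (+ m / suc d)  ≃⟨ ℚ.toℚᵘ-fromℚᵘ (ℚᵘ.mkℚᵘ (+ m) d) ⟩
    ℚᵘ.mkℚᵘ (+ m) d       ≤⟨ ℚᵘ.*≤* cross ⟩
    ℚᵘ.mkℚᵘ (+ p) q       ≃⟨ ℚ.toℚᵘ-fromℚᵘ (ℚᵘ.mkℚᵘ (+ p) q) ⟨
    ℚ.toℚᵘ (+ p / suc q)  ∎)
    where
    open ℚᵘ.≤-Reasoning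

    cross : + m ℤ.* + suc q ℤ.≤ + p ℤ.* + suc d
    cross = subst (ℤ._≤ _) (trans (cong +_ (ℕ.*-comm (suc q) m)) (ℤ.pos-* m (suc q)))
              (subst (_ ℤ.≤_) (ℤ.pos-* p (suc d)) (ℤ.+≤+ qm≤pd))

  k!*nCk≡nP′k : ∀ {n k} → k ℕ.≤ n → k ! * (n C k) ≡ n P′ k
  k!*nCk≡nP′k {n} {k} k≤n = begin
    k ! * (n C k)             ≡⟨ cong (k ! *_) (nCk≡nPk/k! k≤n) ⟩
    k ! * ((n P k) ℕ./ k !)   ≡⟨ cong (λ x → k ! * (x ℕ./ k !)) nPk≡nP′k ⟩
    k ! * ((n P′ k) ℕ./ k !)  ≡⟨ m*[n/m]≡n (k!∣nP′k k≤n) ⟩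
    n P′ k                    ∎
    where
    open ≡-Reasoning
    instance _ = k ℕ.!≢0

    nPk≡nP′k : n P k ≡ n P′ k
    nPk≡nP′k = cong (if_then n P′ k else 0) (Equivalence.to T-≡ (ℕ.≤⇒≤ᵇ k≤n))

  -- Factor by factor, (N - i) / N ≤ (n - i) / n for N ≤ n, with denominators cleared.
  P′-ratio-mono : ∀ {N n} k → N ℕ.≤ n → (N P′ k) * n ^ k ℕ.≤ N ^ k * (n P′ k)
  P′-ratio-mono         zero    N≤n = ℕ.≤-refl
  P′-ratio-mono {N} {n} (suc k) N≤n = begin
    (N ∸ k) * (N P′ k) * (n * n ^ k)  ≡⟨ interchange (N ∸ k) (N P′ k) n (n ^ k) ⟩
    (N ∸ k) * n * ((N P′ k) * n ^ k)  ≤⟨ ℕ.*-mono-≤ factor (P′-ratio-mono k N≤n) ⟩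
    N * (n ∸ k) * (N ^ k * (n P′ k))  ≡⟨ interchange N (n ∸ k) (N ^ k) (n P′ k) ⟩
    N * N ^ k * ((n ∸ k) * (n P′ k))  ∎
    where
    open ℕ.≤-Reasoning

    factor : (N ∸ k) * n ℕ.≤ N * (n ∸ k)
    factor = begin
      (N ∸ k) * n    ≡⟨ ℕ.*-distribʳ-∸ n N k ⟩
      N * n ∸ k * n  ≤⟨ ℕ.∸-monoʳ-≤ (N * n) (ℕ.*-monoʳ-≤ k N≤n) ⟩
      N * n ∸ k * N  ≡⟨ cong (N * n ∸_) (ℕ.*-comm k N) ⟩
      N * n ∸ N * k  ≡⟨ ℕ.*-distribˡ-∸ N n k ⟨
      N * (n ∸ k)    ∎

  -- Since (N P′ k) / N ^ k increases to 1, one N satisfying the numerical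
  -- condition serves all n ≥ N.
  inducibility≤ : ∀ {k} (Γ : Orgraph (Fin k)) A B p q N
                  .{{_ : NonZero q}} .{{_ : NonZero (A * (N P′ k))}} →
                  (∀ n → N ℕ.≤ n → (G : Orgraph (Fin n)) → A * copies Γ G ℕ.≤ B * n ^ k) →
                  k ℕ.≤ N → q * B * N ^ k * k ! ℕ.≤ p * (A * (N P′ k)) →
                  inducibility Γ ≤ fromℚ (+ p / q)
  inducibility≤ {k} Γ A B p q N bound k≤N large =
    limsup≤ (λ n → ratio (max Γ n) (n C k)) N (λ m → ratio≤ (max Γ (N ℕ.+ m)) ((N ℕ.+ m) C k) p q (cleared (ℕ.m≤m+n N m)))
    where
    open ℕ.≤-Reasoning

    cleared : ∀ {n} → N ℕ.≤ n → q * max Γ n ℕ.≤ p * (n C k)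
    -- After scaling by `A * (N P′ k)`, `bound` brings in `n ^ k`, monotonicity trades it for
    -- `n P′ k`, and only the numerical condition `large` remains.
    cleared {n} N≤n = ℕ.*-cancelˡ-≤ (A * (N P′ k)) (begin
      A * (N P′ k) * (q * x)           ≡⟨ interchange A (N P′ k) q x ⟩
      A * q * ((N P′ k) * x)           ≡⟨ cong (_* ((N P′ k) * x)) (ℕ.*-comm A q) ⟩
      q * A * ((N P′ k) * x)           ≡⟨ interchange q A (N P′ k) x ⟩
      -- The omitted orgraph is the maximiser in the definition of `max`.
      q * (N P′ k) * (A * x)           ≤⟨ ℕ.*-monoʳ-≤ (q * (N P′ k)) (bound n N≤n _) ⟩
      q * (N P′ k) * (B * n ^ k)       ≡⟨ interchange q (N P′ k) B (n ^ k) ⟩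
      q * B * ((N P′ k) * n ^ k)       ≤⟨ ℕ.*-monoʳ-≤ (q * B) (P′-ratio-mono k N≤n) ⟩
      q * B * (N ^ k * (n P′ k))       ≡⟨ ℕ.*-assoc (q * B) (N ^ k) (n P′ k) ⟨
      q * B * N ^ k * (n P′ k)         ≡⟨ cong (q * B * N ^ k *_) (k!*nCk≡nP′k (ℕ.≤-trans k≤N N≤n)) ⟨
      q * B * N ^ k * (k ! * (n C k))  ≡⟨ ℕ.*-assoc (q * B * N ^ k) (k !) (n C k) ⟨
      q * B * N ^ k * k ! * (n C k)    ≤⟨ ℕ.*-monoˡ-≤ (n C k) large ⟩
      p * (A * (N P′ k)) * (n C k)     ≡⟨ xy∙z≈y∙xz p (A * (N P′ k)) (n C k) ⟩
      A * (N P′ k) * (p * (n C k))     ∎)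
      where x = max Γ n

-- Copies and embeddings

-- Delete one occurrence of the head from `ys`; the tail of `xs` avoids the head, so it still lies
-- in what is left.
Unique-⊆⇒length≤ : ∀ {A : Set} {xs ys : List A} → Unique xs → xs ⊆ ys → length xs ℕ.≤ length ys
Unique-⊆⇒length≤ [] xs⊆ys = ℕ.z≤n
Unique-⊆⇒length≤ {xs = x ∷ xs} (x∉xs ∷ u) xs⊆ys with ∈-∃++ (xs⊆ys (here refl))
... | as , bs , refl = subst (suc (length xs) ℕ.≤_) (sym (length-++-sucʳ as x bs))
                         (ℕ.s≤s (Unique-⊆⇒length≤ u xs⊆as++bs))
  where
  xs⊆as++bs : xs ⊆ as ++ bs
  xs⊆as++bs y∈xs with ∈-++⁻ as (xs⊆ys (there y∈xs))
  ... | inj₁ y∈as         = ∈-++⁺ˡ y∈as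
  ... | inj₂ (here refl)  = contradiction refl (All.lookup x∉xs y∈xs)
  ... | inj₂ (there y∈bs) = ∈-++⁺ʳ as y∈bs

map-injective : ∀ {A B : Set} {f : A → B} → (∀ {x y} → f x ≡ f y → x ≡ y) →
                ∀ {n} {xs ys : Vec A n} → Vec.map f xs ≡ Vec.map f ys → xs ≡ ys
map-injective inj {xs = []}     {[]}     _  = refl
map-injective inj {xs = x ∷ xs} {y ∷ ys} eq =
  cong₂ _∷_ (inj (proj₁ (∷-injective eq))) (map-injective inj (proj₂ (∷-injective eq)))

Embeds : ∀ {k n} → Orgraph (Fin k) → Orgraph (Fin n) → Vec (Fin n) k → Set
Embeds Γ G f = ∀ i j → edge G (lookup f i) (lookup f j) ≡ edge Γ i j

embeds? : ∀ {k n} (Γ : Orgraph (Fin k)) (G : Orgraph (Fin n)) → Decidable (Embeds Γ G)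
embeds? Γ G f = Fin.all? λ i → Fin.all? λ j → edge G (lookup f i) (lookup f j) Bool.≟ edge Γ i j

count : ∀ {n k} {P : Vec (Fin n) k → Set} → Decidable P → ℕ
count {n} {k} P? = length (filter P? (vecs (allFin n) k))

embeddings : ∀ {k n} → Orgraph (Fin k) → Orgraph (Fin n) → ℕ
embeddings Γ G = count (embeds? Γ G)

-- A listing of all of Γ inside Γ is an automorphism. As a filtered finite list, the group has an
-- order that evaluates to a numeral.
automorphisms : ∀ {k} → Orgraph (Fin k) → List (Vec (Fin k) k)
automorphisms {k} Γ = filter (lists? Γ Γ ⊤) (vecs (allFin k) k)

module _ {k n} {Γ : Orgraph (Fin k)} {G : Orgraph (Fin n)} where

  -- Both sets are the image of `f`.
  lists-determines : ∀ {T U f} → Lists Γ G T f → Lists Γ G U f → T ≡ U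
  lists-determines {f = f} (f∈T , surT , _) (f∈U , surU , _) =
    ⊆-antisym (λ {v} v∈T → let i , fi≡v = surT v v∈T in subst (Subset._∈ _) fi≡v (f∈U i))
              (λ {v} v∈U → let i , fi≡v = surU v v∈U in subst (Subset._∈ _) fi≡v (f∈T i))

  lists-∘ : ∀ {T f σ} → Lists Γ G T f → Lists Γ Γ ⊤ σ → Lists Γ G T (Vec.map (lookup f) σ)
  lists-∘ {T} {f} {σ} (f∈T , sur , inj , edges) (_ , surσ , injσ , edgesσ) =
      (λ i → subst (Subset._∈ T) (sym (at i)) (f∈T (lookup σ i)))
    , (λ v v∈T → let i , fi≡v = sur v v∈T ; j , σj≡i = surσ i ∈⊤ in
         j , trans (at j) (trans (cong (lookup f) σj≡i) fi≡v))
    , (λ i j eq → injσ i j (inj _ _ (trans (sym (at i)) (trans eq (at j)))))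
    , (λ i j → trans (cong₂ (edge G) (at i) (at j)) (trans (edges _ _) (edgesσ i j)))
    where
    at : ∀ i → lookup (Vec.map (lookup f) σ) i ≡ lookup f (lookup σ i)
    at i = lookup-map i (lookup f) σ

  -- Each copy T is listed by f ∘ σ for every automorphism σ, and f ∘ σ
  -- determines T.
  listings : ∀ Ts → Unique Ts → All (IsCopy Γ G) Ts →
             ∃[ fs ] Unique fs × All (λ f → Any (λ T → Lists Γ G T f) Ts) fs ×
                     length fs ≡ length Ts ℕ.* length (automorphisms Γ)
  listings []       _          _                = [] , [] , [] , refl
  listings (T ∷ Ts) (T∉Ts ∷ u) ((_ , iso) ∷ cs) =
    let f , f-lists = ≅⇒lists iso
        fs , unique , listing , len = listings Ts u cs
        new = map (Vec.map (lookup f)) (automorphisms Γ)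

        new-lists : ∀ {g} → g ∈ new → Lists Γ G T g
        new-lists g∈new = let σ , σ∈ , g≡ = ∈-map⁻ _ g∈new in
          subst (Lists Γ G T) (sym g≡)
            (lists-∘ {f = f} {σ} f-lists (proj₂ (∈-filter⁻ (lists? Γ Γ ⊤) {xs = vecs (allFin k) k} σ∈)))

        disjoint : Disjoint new fs
        disjoint {g} (g∈new , g∈fs) =
          let T≢U , U-lists = All.lookupAny T∉Ts (All.lookup listing g∈fs)
          in T≢U (lists-determines {f = g} (new-lists g∈new) U-lists)
    in  new ++ fs
      -- Since `f` is injective, distinct σ give distinct f ∘ σ.
      , Unique.++⁺ (Unique.map⁺ (map-injective (λ {i} {j} → proj₁ (proj₂ (proj₂ f-lists)) i j))
                     (Unique.filter⁺ (lists? Γ Γ ⊤) (vecs-unique (Unique.allFin⁺ k) k)))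
                   unique disjoint
      , All.++⁺ (All.tabulate (here ∘ new-lists)) (All.map there listing)
      , trans (length-++ new) (cong₂ ℕ._+_ (length-map _ (automorphisms Γ)) len)

-- Every listing of a copy is an embedding, and `listings` supplies pairwise distinct ones, as many
-- for each copy as Γ has automorphisms.
copies≤embeddings : ∀ {k n} (Γ : Orgraph (Fin k)) (G : Orgraph (Fin n)) →
                    copies Γ G ℕ.* length (automorphisms Γ) ℕ.≤ embeddings Γ G
copies≤embeddings {n = n} Γ G =
  let fs , unique , listing , len = listings {Γ = Γ} {G} (filter (isCopy? Γ G) (subsets n))
        (Unique.filter⁺ (isCopy? Γ G) (subsets-unique n)) (All.all-filter (isCopy? Γ G) (subsets n))
  in subst (ℕ._≤ embeddings Γ G) len (Unique-⊆⇒length≤ unique λ {f} f∈fs →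
       let _ , _ , _ , _ , embeds = Any.satisfied (All.lookup listing f∈fs)
       in ∈-filter⁺ (embeds? Γ G) (∈-vecs ∈-allFin f) embeds)

-- Counting tuples by iterated integer sums

length-filter-map : ∀ {A B : Set} {P : B → Set} (P? : Decidable P) (f : A → B) xs →
                    length (filter P? (map f xs)) ≡ length (filter (P? ∘ f) xs)
length-filter-map P? f []       = refl
length-filter-map P? f (x ∷ xs) with does (P? (f x))
... | true  = cong suc (length-filter-map P? f xs)
... | false = length-filter-map P? f xs

module _ where
  open import Data.Integer using (_+_; _*_)

  -- Opaque, so that unification can read f off ∑ f.
  opaque
    ∑ : ∀ {n} → (Fin n → ℤ) → ℤ
    ∑ = sum

    ∑-zero : (f : Fin 0 → ℤ) → ∑ f ≡ 0ℤ
    ∑-zero f = refl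

    ∑-suc : ∀ {n} (f : Fin (suc n) → ℤ) → ∑ f ≡ f zero + ∑ (f ∘ suc)
    ∑-suc f = refl

    ∑-cong : ∀ {n} {f g : Fin n → ℤ} → (∀ i → f i ≡ g i) → ∑ f ≡ ∑ g
    ∑-cong = sum-cong-≗

    ∑-comm : ∀ {m n} (f : Fin m → Fin n → ℤ) → ∑ (λ i → ∑ (λ j → f i j)) ≡ ∑ (λ j → ∑ (λ i → f i j))
    ∑-comm = Sum.∑-comm

    ∑-+ : ∀ {n} (f g : Fin n → ℤ) → ∑ (λ i → f i + g i) ≡ ∑ f + ∑ g
    ∑-+ = ∑-distrib-+

    *-∑ : ∀ {n} x (f : Fin n → ℤ) → x * ∑ f ≡ ∑ (λ i → x * f i)
    *-∑ = *-distribˡ-sum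

    ∑-* : ∀ {n} x (f : Fin n → ℤ) → ∑ f * x ≡ ∑ (λ i → f i * x)
    ∑-* = *-distribʳ-sum

  ∑-mono : ∀ {n} {f g : Fin n → ℤ} → (∀ i → f i ℤ.≤ g i) → ∑ f ℤ.≤ ∑ g
  ∑-mono {zero}  {f} {g} f≤g = ℤ.≤-reflexive (trans (∑-zero f) (sym (∑-zero g)))
  ∑-mono {suc n} {f} {g} f≤g = begin
    ∑ f                   ≡⟨ ∑-suc f ⟩
    f zero + ∑ (f ∘ suc)  ≤⟨ ℤ.+-mono-≤ (f≤g zero) (∑-mono (f≤g ∘ suc)) ⟩
    g zero + ∑ (g ∘ suc)  ≡⟨ ∑-suc g ⟨
    ∑ g                   ∎
    where open ℤ.≤-Reasoning

  ∑-const : ∀ n x → ∑ {n} (λ _ → x) ≡ + n * x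
  ∑-const zero    x = trans (∑-zero _) (sym (ℤ.*-zeroˡ x))
  ∑-const (suc n) x = begin
    ∑ {suc n} (λ _ → x)    ≡⟨ ∑-suc (λ _ → x) ⟩
    x + ∑ {n} (λ _ → x)    ≡⟨ cong (λ y → x + y) (∑-const n x) ⟩
    x + + n * x            ≡⟨ ℤ.suc-* (+ n) x ⟨
    + suc n * x            ∎
    where open ≡-Reasoning

  ∑-nonNeg : ∀ {n} {f : Fin n → ℤ} → (∀ i → 0ℤ ℤ.≤ f i) → 0ℤ ℤ.≤ ∑ f
  ∑-nonNeg {n} 0≤f = ℤ.≤-trans (ℤ.≤-reflexive (sym (trans (∑-const n 0ℤ) (ℤ.*-zeroʳ (+ n))))) (∑-mono 0≤f)

  count-suc : ∀ {n k} {P : Vec (Fin n) (suc k) → Set} (P? : Decidable P) →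
              + count P? ≡ ∑ (λ x → + count (λ v → P? (x ∷ v)))
  count-suc {n} {k} {P} P? = go (λ i → i)
    where
    vs = vecs (allFin n) k

    -- `allFin n` is a `tabulate`; the induction shortens its domain while the entries stay in
    -- `Fin n`, hence the general `g`.
    go : ∀ {m} (g : Fin m → Fin n) →
         + length (filter P? (cartesianProductWith _∷_ (tabulate g) vs)) ≡
         ∑ (λ i → + length (filter (λ v → P? (g i ∷ v)) vs))
    go {zero}  g = sym (∑-zero _)
    go {suc m} g = begin
      + length (filter P? (map (g 0F ∷_) vs ++ rest))
        ≡⟨ cong (+_ ∘ length) (filter-++ P? (map (g 0F ∷_) vs) rest) ⟩
      + length (filter P? (map (g 0F ∷_) vs) ++ filter P? rest)
        ≡⟨ cong +_ (length-++ (filter P? (map (g 0F ∷_) vs))) ⟩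
      + length (filter P? (map (g 0F ∷_) vs)) + + length (filter P? rest)
        ≡⟨ cong₂ _+_ (cong +_ (length-filter-map P? (g 0F ∷_) vs)) (go (g ∘ suc)) ⟩
      + length (filter (λ v → P? (g 0F ∷ v)) vs) + ∑ (λ i → + length (filter (λ v → P? (g (suc i) ∷ v)) vs))
        ≡⟨ ∑-suc _ ⟨
      ∑ (λ i → + length (filter (λ v → P? (g i ∷ v)) vs)) ∎
      where
      open ≡-Reasoning
      rest = cartesianProductWith _∷_ (tabulate (g ∘ suc)) vs

  -- Peels off one vertex at a time: repeated use, closed by `*-count-zero≤`, reduces a bound on a
  -- count to a check on a single tuple.
  *-count-suc≤ : ∀ m {n k} {P : Vec (Fin n) (suc k) → Set} (P? : Decidable P) {f : Fin n → ℤ} →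
                 (∀ x → + m * + count (λ v → P? (x ∷ v)) ℤ.≤ f x) → + m * + count P? ℤ.≤ ∑ f
  *-count-suc≤ m P? {f} count≤f = begin
    + m * + count P?                                 ≡⟨ cong (+ m *_) (count-suc P?) ⟩
    + m * ∑ (λ x → + count (λ v → P? (x ∷ v)))     ≡⟨ *-∑ (+ m) _ ⟩
    ∑ (λ x → + m * + count (λ v → P? (x ∷ v)))     ≤⟨ ∑-mono count≤f ⟩
    ∑ f                                            ∎
    where open ℤ.≤-Reasoning

  *-count-zero≤ : ∀ m {n} {P : Vec (Fin n) 0 → Set} (P? : Decidable P) {x : ℤ} →
                  0ℤ ℤ.≤ x → (P [] → + m ℤ.≤ x) → + m * + count P? ℤ.≤ x
  *-count-zero≤ m P? 0≤x m≤x with P? []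
  ... | yes p = ℤ.≤-trans (ℤ.≤-reflexive (ℤ.*-identityʳ (+ m))) (m≤x p)
  ... | no  _ = ℤ.≤-trans (ℤ.≤-reflexive (ℤ.*-zeroʳ (+ m))) 0≤x

-- Sums over quadruples

data Rel : Set where
  none fwd bwd : Rel

⟨_,_,_⟩ : ∀ {A : Set} → A → A → A → Rel → A
⟨ x , y , z ⟩ none = x
⟨ x , y , z ⟩ fwd  = y
⟨ x , y , z ⟩ bwd  = z

flip : Rel → Rel
flip = ⟨ none , bwd , fwd ⟩

-- Two opposite edges would be read as `fwd`; `rel-flip` excludes that case by orientedness.
toRel : Bool → Bool → Rel
toRel true  _     = fwd
toRel false true  = bwd
toRel false false = none

record Config : Set where
  constructor config
  field ab ac ad bc bd cd : Rel

open Config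

swap-ab swap-bc swap-cd : Config → Config
swap-ab (config ab ac ad bc bd cd) = config (flip ab) bc bd ac ad cd
swap-bc (config ab ac ad bc bd cd) = config ac ab ad (flip bc) cd bd
swap-cd (config ab ac ad bc bd cd) = config ab ad ac bd bc (flip cd)

config-cong : ∀ {ab ac ad bc bd cd ab′ ac′ ad′ bc′ bd′ cd′} →
              ab ≡ ab′ → ac ≡ ac′ → ad ≡ ad′ → bc ≡ bc′ → bd ≡ bd′ → cd ≡ cd′ →
              config ab ac ad bc bd cd ≡ config ab′ ac′ ad′ bc′ bd′ cd′
config-cong refl refl refl refl refl refl = refl

all-rel? : {P : Rel → Set} → Decidable P → Dec (∀ r → P r)
all-rel? P? = map′ (λ { (p , q , r) none → p ; (p , q , r) fwd → q ; (p , q , r) bwd → r })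
                   (λ p → p none , p fwd , p bwd)
                   (P? none ×-dec P? fwd ×-dec P? bwd)

-- Makes a claim about all 3⁶ = 729 configurations provable by evaluation.
all-config? : {P : Config → Set} → Decidable P → Dec (∀ c → P c)
all-config? P? = map′ (λ p c → p (ab c) (ac c) (ad c) (bc c) (bd c) (cd c)) (λ p _ _ _ _ _ _ → p _)
  (all-rel? λ ab → all-rel? λ ac → all-rel? λ ad → all-rel? λ bc → all-rel? λ bd → all-rel? λ cd →
   P? (config ab ac ad bc bd cd))

-- The weight depends on the relation of the two roots a, b, and the flag on the
-- relations of the roots to one further vertex.
record Square : Set where
  constructor square
  field
    weight : Rel → ℕ
    flag   : Rel → Rel → ℤ

open Square

module _ where
  open import Data.Integer using (_+_; _*_)

  term : Square → Config → ℤ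
  term s c = + weight s (ab c) * (flag s (ac c) (bc c) * flag s (ad c) (bd c))

  squares : List Square → Config → ℤ
  squares []       c = 0ℤ
  squares (s ∷ ss) c = term s c + squares ss c

  -- Every permutation of {a , b , c , d} is a unique product y₃ y₂ y₁ with
  -- y₃ ∈ {1 , cd , bc·cd , ab·bc·cd}, y₂ ∈ {1 , bc , ab·bc} and y₁ ∈ {1 , ab}.
  sym₁ sym₂ sym₃ symmetrise : (Config → ℤ) → Config → ℤ
  sym₁ F c = F c + F (swap-ab c)
  sym₂ F c = F c + sym₁ F (swap-bc c)
  sym₃ F c = F c + sym₂ F (swap-cd c)
  symmetrise F = sym₁ (sym₂ (sym₃ F))

  module _ {n} (G : Orgraph (Fin n)) where

    rel : Fin n → Fin n → Rel
    rel u v = toRel (edge G u v) (edge G v u)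

    rel-flip : ∀ u v → rel v u ≡ flip (rel u v)
    rel-flip u v with edge G u v in uv | edge G v u in vu
    ... | false | false = refl
    ... | false | true  = refl
    ... | true  | false = refl
    ... | true  | true  with trans (sym vu) (oriented G u v uv)
    ...   | ()

    configuration : (a b c d : Fin n) → Config
    configuration a b c d = config (rel a b) (rel a c) (rel a d) (rel b c) (rel b d) (rel c d)

    total : (Config → ℤ) → ℤ
    total F = ∑ λ a → ∑ λ b → ∑ λ c → ∑ λ d → F (configuration a b c d)

    total-mono : ∀ {F H} → (∀ c → F c ℤ.≤ H c) → total F ℤ.≤ total H
    total-mono F≤H = ∑-mono λ a → ∑-mono λ b → ∑-mono λ c → ∑-mono λ d → F≤H (configuration a b c d)

    total-const : ∀ x → total (λ _ → x) ≡ + n * (+ n * (+ n * (+ n * x)))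
    total-const x = begin
      (∑ {n} λ _ → ∑ {n} λ _ → ∑ {n} λ _ → ∑ {n} λ _ → x)
        ≡⟨ (∑-cong {n} λ _ → ∑-cong {n} λ _ → ∑-cong {n} λ _ → ∑-const n x) ⟩
      (∑ {n} λ _ → ∑ {n} λ _ → ∑ {n} λ _ → + n * x)
        ≡⟨ (∑-cong {n} λ _ → ∑-cong {n} λ _ → ∑-const n _) ⟩
      (∑ {n} λ _ → ∑ {n} λ _ → + n * (+ n * x))
        ≡⟨ (∑-cong {n} λ _ → ∑-const n _) ⟩
      (∑ {n} λ _ → + n * (+ n * (+ n * x)))
        ≡⟨ ∑-const n _ ⟩
      + n * (+ n * (+ n * (+ n * x))) ∎
      where open ≡-Reasoning

    total-+ : ∀ F H → total (λ c → F c + H c) ≡ total F + total H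
    total-+ F H =
      trans (∑-cong λ a →
        trans (∑-cong λ b →
          trans (∑-cong λ c → ∑-+ (λ d → F (configuration a b c d)) _) (∑-+ _ _))
          (∑-+ _ _))
        (∑-+ _ _)

    total-* : ∀ x F → total (λ c → x * F c) ≡ x * total F
    total-* x F = sym (
      trans (*-∑ x _) (∑-cong λ a →
        trans (*-∑ x _) (∑-cong λ b →
          trans (*-∑ x _) (∑-cong λ c → *-∑ x _))))

    -- By `rel-flip`, `swap-ab` yields the configuration of (b , a , c , d); exchanging the two
    -- outer sums renames it back. The other two swaps work alike.
    total-swap-ab : ∀ F → total (F ∘ swap-ab) ≡ total F
    total-swap-ab F = trans
      (∑-cong λ a → ∑-cong λ b → ∑-cong λ c → ∑-cong λ d →
        cong (λ r → F (config r (rel b c) (rel b d) (rel a c) (rel a d) (rel c d))) (sym (rel-flip a b)))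
      (∑-comm λ a b → ∑ λ c → ∑ λ d → F (configuration b a c d))

    total-swap-bc : ∀ F → total (F ∘ swap-bc) ≡ total F
    total-swap-bc F = ∑-cong λ a → trans
      (∑-cong λ b → ∑-cong λ c → ∑-cong λ d →
        cong (λ r → F (config (rel a c) (rel a b) (rel a d) r (rel c d) (rel b d))) (sym (rel-flip b c)))
      (∑-comm λ b c → ∑ λ d → F (configuration a c b d))

    total-swap-cd : ∀ F → total (F ∘ swap-cd) ≡ total F
    total-swap-cd F = ∑-cong λ a → ∑-cong λ b → trans
      (∑-cong λ c → ∑-cong λ d →
        cong (λ r → F (config (rel a b) (rel a d) (rel a c) (rel b d) (rel b c) r)) (sym (rel-flip c d)))
      (∑-comm λ c d → F (configuration a b d c))

    -- Swaps preserve `total`, so `sym₁`, `sym₂`, `sym₃` multiply it by their numbers of summands 2,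
    -- 3, 4, with product 24.
    total-sym₁ : ∀ F → total (sym₁ F) ≡ + 2 * total F
    total-sym₁ F = begin
      total (sym₁ F)                   ≡⟨ total-+ F (F ∘ swap-ab) ⟩
      total F + total (F ∘ swap-ab)    ≡⟨ cong (λ x → total F + x) (total-swap-ab F) ⟩
      total F + total F                ≡⟨ cong (λ x → total F + x) (ℤ.*-identityˡ (total F)) ⟨
      total F + + 1 * total F          ≡⟨ ℤ.suc-* (+ 1) (total F) ⟨
      + 2 * total F                    ∎
      where open ≡-Reasoning

    total-sym₂ : ∀ F → total (sym₂ F) ≡ + 3 * total F
    total-sym₂ F = begin
      total (sym₂ F)                        ≡⟨ total-+ F (sym₁ F ∘ swap-bc) ⟩
      total F + total (sym₁ F ∘ swap-bc)    ≡⟨ cong (λ x → total F + x) (trans (total-swap-bc (sym₁ F)) (total-sym₁ F)) ⟩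
      total F + + 2 * total F               ≡⟨ ℤ.suc-* (+ 2) (total F) ⟨
      + 3 * total F                         ∎
      where open ≡-Reasoning

    total-sym₃ : ∀ F → total (sym₃ F) ≡ + 4 * total F
    total-sym₃ F = begin
      total (sym₃ F)                        ≡⟨ total-+ F (sym₂ F ∘ swap-cd) ⟩
      total F + total (sym₂ F ∘ swap-cd)    ≡⟨ cong (λ x → total F + x) (trans (total-swap-cd (sym₂ F)) (total-sym₂ F)) ⟩
      total F + + 3 * total F               ≡⟨ ℤ.suc-* (+ 3) (total F) ⟨
      + 4 * total F                         ∎
      where open ≡-Reasoning

    total-symmetrise : ∀ F → total (symmetrise F) ≡ + 24 * total F
    total-symmetrise F = begin
      total (symmetrise F)              ≡⟨ total-sym₁ (sym₂ (sym₃ F)) ⟩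
      + 2 * total (sym₂ (sym₃ F))       ≡⟨ cong (+ 2 *_) (total-sym₂ (sym₃ F)) ⟩
      + 2 * (+ 3 * total (sym₃ F))      ≡⟨ cong (λ x → + 2 * (+ 3 * x)) (total-sym₃ F) ⟩
      + 2 * (+ 3 * (+ 4 * total F))     ≡⟨ ℤ.*-assoc (+ 2) (+ 3) (+ 4 * total F) ⟨
      + 6 * (+ 4 * total F)             ≡⟨ ℤ.*-assoc (+ 6) (+ 4) (total F) ⟨
      + 24 * total F                    ∎
      where open ≡-Reasoning

    -- With a and b fixed, c and d range independently, c = d included, so the inner double sum is
    -- exactly the weight times (∑ f)².
    0≤total-term : ∀ s → 0ℤ ℤ.≤ total (term s)
    0≤total-term s = ∑-nonNeg λ a → ∑-nonNeg λ b →
      let w = weight s (rel a b)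
          f = λ c → flag s (rel a c) (rel b c)
      in subst (0ℤ ℤ.≤_) (begin
           + w * (∑ f * ∑ f)                  ≡⟨ cong (+ w *_) (∑-* (∑ f) f) ⟩
           + w * ∑ (λ c → f c * ∑ f)          ≡⟨ *-∑ (+ w) (λ c → f c * ∑ f) ⟩
           ∑ (λ c → + w * (f c * ∑ f))        ≡⟨ (∑-cong λ c → cong (+ w *_) (*-∑ (f c) f)) ⟩
           ∑ (λ c → + w * ∑ λ d → f c * f d)  ≡⟨ (∑-cong λ c → *-∑ (+ w) (λ d → f c * f d)) ⟩
           (∑ λ c → ∑ λ d → + w * (f c * f d)) ∎)
         (0≤w*x² w (∑ f))
      where
      open ≡-Reasoning

      0≤w*x² : ∀ w x → 0ℤ ℤ.≤ + w * (x * x)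
      0≤w*x² w (+ m)      = subst (0ℤ ℤ.≤_) (trans (ℤ.pos-* w (m ℕ.* m)) (cong (+ w *_) (ℤ.pos-* m m))) (ℤ.+≤+ ℕ.z≤n)
      0≤w*x² w ℤ.-[1+ m ] = subst (0ℤ ℤ.≤_) (ℤ.pos-* w (suc m ℕ.* suc m)) (ℤ.+≤+ ℕ.z≤n)

    0≤total-squares : ∀ ss → 0ℤ ℤ.≤ total (squares ss)
    0≤total-squares []       = ∑-nonNeg λ a → ∑-nonNeg λ b → ∑-nonNeg λ c → ∑-nonNeg λ d → ℤ.≤-refl
    0≤total-squares (s ∷ ss) = subst (0ℤ ℤ.≤_) (sym (total-+ (term s) (squares ss)))
      (ℤ.+-mono-≤ (0≤total-term s) (0≤total-squares ss))

    -- Adding the squares can only raise the total, and symmetrising multiplies it by 24. The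
    -- pointwise bound then applies to every quadruple, and 24 cancels.
    certified : ∀ A B (F : Config → ℕ) ss →
                (∀ c → symmetrise (λ c → + A * + F c + squares ss c) c ℤ.≤ + 24 * + B) →
                + A * total (+_ ∘ F) ℤ.≤ + n * (+ n * (+ n * (+ n * + B)))
    certified A B F ss pointwise = ℤ.*-cancelˡ-≤-pos _ _ (+ 24) (begin
      + 24 * (+ A * total (+_ ∘ F))
        ≡⟨ cong (+ 24 *_) (ℤ.+-identityʳ _) ⟨
      + 24 * (+ A * total (+_ ∘ F) + 0ℤ)
        ≤⟨ ℤ.*-monoˡ-≤-nonNeg (+ 24) (ℤ.+-monoʳ-≤ (+ A * total (+_ ∘ F)) (0≤total-squares ss)) ⟩
      + 24 * (+ A * total (+_ ∘ F) + total (squares ss))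
        ≡⟨ cong (λ x → + 24 * (x + total (squares ss))) (total-* (+ A) (+_ ∘ F)) ⟨
      + 24 * (total (λ c → + A * + F c) + total (squares ss))
        ≡⟨ cong (+ 24 *_) (total-+ (λ c → + A * + F c) (squares ss)) ⟨
      + 24 * total (λ c → + A * + F c + squares ss c)
        ≡⟨ total-symmetrise (λ c → + A * + F c + squares ss c) ⟨
      total (symmetrise (λ c → + A * + F c + squares ss c))
        ≤⟨ total-mono pointwise ⟩
      total (λ _ → + 24 * + B)
        ≡⟨ total-* (+ 24) (λ _ → + B) ⟩
      + 24 * total (λ _ → + B)
        ≡⟨ cong (+ 24 *_) (total-const (+ B)) ⟩
      + 24 * (+ n * (+ n * (+ n * (+ n * + B)))) ∎)
      where open ℤ.≤-Reasoning

-- Certificates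

-- Indicators of the induced patterns a → b → c, with d free, and a → b → c → d → a.
path cycle : Config → ℕ
path (config fwd none _ fwd _ _) = 1
path _                           = 0
cycle (config fwd none bwd fwd none fwd) = 1
cycle _                                  = 0

-- Rounded from numerical solutions of the semidefinite programs whose constraints
-- are path-pointwise and cycle-pointwise.
path-squares cycle-squares : List Square
path-squares =
  square ⟨ 0 , 4 , 0 ⟩ ⟨ ⟨ + 0 , - + 3 , + 3 ⟩ , ⟨ + 3 , + 1 , + 4 ⟩ , ⟨ - + 3 , + 0 , + 1 ⟩ ⟩ ∷
  square ⟨ 0 , 4 , 0 ⟩ ⟨ ⟨ + 0 , + 5 , - + 1 ⟩ , ⟨ + 1 , + 2 , + 0 ⟩ , ⟨ - + 5 , + 0 , - + 2 ⟩ ⟩ ∷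
  square ⟨ 1 , 0 , 0 ⟩ ⟨ ⟨ + 3 , + 4 , + 4 ⟩ , ⟨ + 4 , + 0 , - + 4 ⟩ , ⟨ + 4 , - + 4 , + 0 ⟩ ⟩ ∷ []
cycle-squares =
  square ⟨ 0 , 4 , 0 ⟩ ⟨ ⟨ - + 1 , - + 3 , + 4 ⟩ , ⟨ + 4 , + 1 , + 4 ⟩ , ⟨ - + 3 , + 0 , + 1 ⟩ ⟩ ∷
  square ⟨ 0 , 21 , 0 ⟩ ⟨ ⟨ + 0 , + 5 , - + 1 ⟩ , ⟨ + 1 , + 2 , + 0 ⟩ , ⟨ - + 5 , + 0 , - + 2 ⟩ ⟩ ∷
  square ⟨ 0 , 8 , 0 ⟩ ⟨ ⟨ + 0 , + 1 , + 1 ⟩ , ⟨ - + 1 , + 2 , + 0 ⟩ , ⟨ - + 1 , + 0 , - + 2 ⟩ ⟩ ∷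
  square ⟨ 1 , 0 , 0 ⟩ ⟨ ⟨ + 4 , + 5 , + 5 ⟩ , ⟨ + 5 , - + 2 , - + 2 ⟩ , ⟨ + 5 , - + 2 , - + 2 ⟩ ⟩ ∷ []

module _ where
  open import Data.Integer using (_+_; _*_)

  -- Checked by evaluation. The constants yield the limiting density 3! · 12 / 164 ≈ 0.4390.
  path-pointwise : ∀ c → symmetrise (λ c → + 164 * + path c + squares path-squares c) c ℤ.≤ + 24 * + 12
  path-pointwise = toWitness {a? = all-config? λ _ → _ ℤ.≤? _} _

  -- Checked by evaluation. With the four automorphisms of `C₄` the constants yield 4! · 20 / 4400 ≈
  -- 0.1091.
  cycle-pointwise : ∀ c → symmetrise (λ c → + 1100 * + cycle c + squares cycle-squares c) c ℤ.≤ + 24 * + 20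
  cycle-pointwise = toWitness {a? = all-config? λ _ → _ ℤ.≤? _} _

  module _ {n} (G : Orgraph (Fin n)) where

    -- Each embedding (a , b , c) extends by any of the n choices of d.
    path-count : + n * + embeddings P₃ G ℤ.≤ total G (+_ ∘ path)
    path-count =
      *-count-suc≤ n (embeds? P₃ G) λ a →
      *-count-suc≤ n (λ v → embeds? P₃ G (a ∷ v)) λ b →
      *-count-suc≤ n (λ v → embeds? P₃ G (a ∷ b ∷ v)) λ c →
      *-count-zero≤ n (λ v → embeds? P₃ G (a ∷ b ∷ c ∷ v)) (∑-nonNeg λ d → ℤ.+≤+ ℕ.z≤n) λ h →
        ℤ.≤-reflexive (sym (begin
          ∑ (λ d → + path (configuration G a b c d))
            -- The embedding fixes the relations among a, b, c; those with d stay arbitrary.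
            ≡⟨ (∑-cong λ d → cong (+_ ∘ path) (config-cong {ad′ = rel G a d} {bd′ = rel G b d} {cd′ = rel G c d}
                 (cong₂ toRel (h 0F 1F) (h 1F 0F)) (cong₂ toRel (h 0F 2F) (h 2F 0F)) refl
                 (cong₂ toRel (h 1F 2F) (h 2F 1F)) refl refl)) ⟩
          ∑ {n} (λ _ → + 1)  ≡⟨ ∑-const n (+ 1) ⟩
          + n * + 1          ≡⟨ ℤ.*-identityʳ (+ n) ⟩
          + n                ∎))
      where open ≡-Reasoning

    -- Here an embedding is itself a quadruple, and it fixes all six relations.
    cycle-count : + 1 * + embeddings C₄ G ℤ.≤ total G (+_ ∘ cycle)
    cycle-count =
      *-count-suc≤ 1 (embeds? C₄ G) λ a →
      *-count-suc≤ 1 (λ v → embeds? C₄ G (a ∷ v)) λ b →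
      *-count-suc≤ 1 (λ v → embeds? C₄ G (a ∷ b ∷ v)) λ c →
      *-count-suc≤ 1 (λ v → embeds? C₄ G (a ∷ b ∷ c ∷ v)) λ d →
      *-count-zero≤ 1 (λ v → embeds? C₄ G (a ∷ b ∷ c ∷ d ∷ v)) (ℤ.+≤+ ℕ.z≤n) λ h →
        ℤ.≤-reflexive (sym (cong (+_ ∘ cycle) (config-cong
          (cong₂ toRel (h 0F 1F) (h 1F 0F)) (cong₂ toRel (h 0F 2F) (h 2F 0F)) (cong₂ toRel (h 0F 3F) (h 3F 0F))
          (cong₂ toRel (h 1F 2F) (h 2F 1F)) (cong₂ toRel (h 1F 3F) (h 3F 1F)) (cong₂ toRel (h 2F 3F) (h 3F 2F)))))

    -- m is the number of ways in which an embedding extends to a quadruple.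
    copies-bound : ∀ {k} (Γ : Orgraph (Fin k)) A B m F ss {s} → length (automorphisms Γ) ≡ s →
                   (∀ c → symmetrise (λ c → + A * + F c + squares ss c) c ℤ.≤ + 24 * + B) →
                   + m * + embeddings Γ G ℤ.≤ total G (+_ ∘ F) →
                   m ℕ.* (A ℕ.* s ℕ.* copies Γ G) ℕ.≤ B ℕ.* n ℕ.^ 4
    copies-bound Γ A B m F ss refl pointwise extends = ℤ.drop‿+≤+ (begin
      + (m ℕ.* (A ℕ.* s ℕ.* x))          ≡⟨ cong +_ (solve 4 (λ m A s x → m :* (A :* s :* x) := A :* (m :* (x :* s))) refl m A s x) ⟩
      + (A ℕ.* (m ℕ.* (x ℕ.* s)))        ≡⟨ trans (ℤ.pos-* A _) (cong (+ A *_) (ℤ.pos-* m _)) ⟩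
      + A * (+ m * + (x ℕ.* s))          ≤⟨ ℤ.*-monoˡ-≤-nonNeg (+ A) (ℤ.*-monoˡ-≤-nonNeg (+ m) (ℤ.+≤+ (copies≤embeddings Γ G))) ⟩
      + A * (+ m * + embeddings Γ G)     ≤⟨ ℤ.*-monoˡ-≤-nonNeg (+ A) extends ⟩
      + A * total G (+_ ∘ F)             ≤⟨ certified G A B F ss pointwise ⟩
      + n * (+ n * (+ n * (+ n * + B)))  ≡⟨ pos-n⁴B ⟨
      + (n ℕ.* (n ℕ.* (n ℕ.* (n ℕ.* B))))
        ≡⟨ cong +_ (solve 2 (λ n B → n :* (n :* (n :* (n :* B))) := B :* (n :^ 4)) refl n B) ⟩
      + (B ℕ.* n ℕ.^ 4)                  ∎)
      where
      open ℤ.≤-Reasoning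
      open import Data.Nat.Solver using (module +-*-Solver)
      open +-*-Solver using (solve; _:*_; _:^_; _:=_)
      s = length (automorphisms Γ)
      x = copies Γ G

      pos-n⁴B : + (n ℕ.* (n ℕ.* (n ℕ.* (n ℕ.* B)))) ≡ + n * (+ n * (+ n * (+ n * + B)))
      pos-n⁴B = trans (ℤ.pos-* n _) (cong (+ n *_) (trans (ℤ.pos-* n _) (cong (+ n *_)
                (trans (ℤ.pos-* n _) (cong (+ n *_) (ℤ.pos-* n B))))))

-- Explicit bounds and the theorem

module _ {n} (G : Orgraph (Fin n)) where
  open import Data.Nat using (_*_; _^_)
  open import Algebra.Properties.CommutativeSemigroup ℕ.*-commutativeSemigroup using (x∙yz≈y∙xz)

  -- The factor n from the free vertex d cancels one power of n. The first `refl` computes that `P₃`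
  -- has a single automorphism.
  P₃-bound : .{{_ : NonZero n}} → 164 * copies P₃ G ℕ.≤ 12 * n ^ 3
  P₃-bound = ℕ.*-cancelˡ-≤ n (subst (n * (164 * copies P₃ G) ℕ.≤_) (x∙yz≈y∙xz 12 n (n ^ 3))
    (copies-bound G P₃ 164 12 n path path-squares refl path-pointwise (path-count G)))

  -- 4400 is 1100 times the number of automorphisms, the four rotations.
  C₄-bound : 4400 * copies C₄ G ℕ.≤ 20 * n ^ 4
  C₄-bound = subst (ℕ._≤ 20 * n ^ 4) (ℕ.*-identityˡ (4400 * copies C₄ G))
    (copies-bound G C₄ 1100 20 1 cycle cycle-squares refl cycle-pointwise (cycle-count G))

theorem2 : inducibility P₃ ≤ fromℚ (+ 4446 / 10000) × inducibility C₄ ≤ fromℚ (+ 1104 / 10000)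
theorem2 =
    -- The certified densities 0.4390 and 0.1091 lie below the targets by more than 1%. At N = 300
    -- and N = 600 the quotient (N P′ k) / N ^ k is about 0.990, which this slack absorbs.
    inducibility≤ P₃ 164 12 4446 10000 300
      (λ n 300≤n G → P₃-bound G {{ℕ.>-nonZero (ℕ.≤-trans (ℕ.s≤s ℕ.z≤n) 300≤n)}})
      (ℕ.≤ᵇ⇒≤ _ _ _) (ℕ.≤ᵇ⇒≤ _ _ _)
  , inducibility≤ C₄ 4400 20 1104 10000 600 (λ _ _ → C₄-bound) (ℕ.≤ᵇ⇒≤ _ _ _) (ℕ.≤ᵇ⇒≤ _ _ _)
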